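{- Let $C$ be a clique cutset in a graph $G$, let $(A,B,C)$ be a cut-partition of $G$, and let $G_A=G[A\cup C]$ and $G_B=G[B\cup C]$. Then $\mathsf{tree}\text{ - }\alpha(G)=\max\{\mathsf{tree}\text{ - }\alpha(G_A),\mathsf{tree}\text{ - }\alpha(G_B)\}$.
   Context: All graphs are finite, simple, and undirected. A cut-partition in a graph $G$ is a triple $(A,B,C)$ of pairwise disjoint sets such that $A\cup B\cup C=V(G)$, $A\neq\emptyset$, $B\neq\emptyset$, and $G$ has no edges with one endpoint in $A$ and one in $B$. A clique cutset in $G$ is a clique $C$ (set of pairwise adjacent vertices) such that $G$ has a cut-partition $(A,B,C)$ for some $A$ and $B$. A tree decomposition of a graph $G$ is a pair $\mathcal{T}=(T,\{X_t\}_{t\in V(T)})$ where $T$ is a tree and each node $t$ is assigned a bag $X_t\subseteq V(G)$ such that every vertex of $G$ is in at least one bag, every edge of $G$ has both endpoints in some common bag, and for every $u\in V(G)$ the subgraph of $T$ induced by $\{t: u\in X_t\}$ is connected. The independence number of $\mathcal{T}$ is $\alpha(\mathcal{T})=\max_{t\in V(T)}\alpha(G[X_t])$, where $\alpha(H)$ is the maximum size of an independent set in $H$. The tree-independence number $\mathsf{tree}\text{ - }\alpha(G)$ is the minimum of $\alpha(\mathcal{T})$ over all tree decompositions $\mathcal{T}$ of $G$. -}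

module Defs where

open import Level using (0ℓ)
open import Data.Nat.Base using (ℕ; zero; suc; _≤_; _<_; _+_; _⊔_; z≤n; s≤s)
import Data.Nat.Properties as ℕₚ
open import Data.Fin.Base using (Fin; zero; suc; punchIn; punchOut)
import Data.Fin.Properties as Finₚ
open import Data.Fin.Subset using (Subset; inside; outside; _∈_; _∉_; _⊆_; _∪_; _∩_; _-_; ⊤; ⊥; ∣_∣; Nonempty; Empty)
import Data.Fin.Subset.Properties as Subₚ
open import Data.Vec.Base using ([]; _∷_; lookup; tabulate; here; there)
import Data.Vec.Properties as Vecₚ
import Data.Vec.Functional as Vector
open import Data.List.Base as List using (List; []; _∷_; _∷ʳ_; length)
import Data.List.Properties as Listₚ
open import Data.List.Relation.Unary.All as All using (All; []; _∷_)
import Data.List.Relation.Unary.All.Properties as Allₚ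
open import Data.List.Relation.Unary.AllPairs using ([]; _∷_)
import Data.List.Relation.Unary.AllPairs.Properties as AllPairsₚ
open import Data.List.Relation.Unary.Any using (here; there)
open import Data.List.Membership.Propositional renaming (_∈_ to _∈ₗ_; _∉_ to _∉ₗ_)
import Data.List.Membership.DecPropositional as DecMem
import Data.List.Membership.Propositional.Properties as Memₚ
open import Data.List.Relation.Unary.Linked as Linked using (Linked; []; [-]; _∷_)
import Data.List.Relation.Unary.Linked.Properties as Linkedₚ
open import Data.List.Relation.Unary.Unique.Propositional using (Unique)
import Data.List.Relation.Unary.Unique.Propositional.Properties as Uniqueₚ
open import Data.Product.Base using (Σ; ∃; _×_; _,_; proj₁; proj₂)
open import Data.Sum.Base using (_⊎_; inj₁; inj₂)
open import Data.Empty using (⊥-elim) renaming (⊥ to ⊥₀)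
open import Data.Unit.Base using (tt) renaming (⊤ to ⊤₀)
open import Function.Base using (_∘_; id)
open import Relation.Nullary using (¬_; Dec; yes; no; contradiction)
open import Relation.Nullary.Decidable as Dec using (¬?; _×-dec_; _⊎-dec_; _→-dec_; decidable-stable)
open import Relation.Unary using (Pred; Decidable)
open import Relation.Binary.Core using (Rel)
import Relation.Binary.Definitions as B
open import Relation.Binary.Construct.Closure.ReflexiveTransitive using (Star; ε; _◅_; _◅◅_)
import Relation.Binary.Construct.Closure.ReflexiveTransitive as Star
open import Relation.Binary.PropositionalEquality using (_≡_; _≢_; refl; sym; trans; cong; subst)

------------------------------------------------------------------------

-- A finite simple undirected graph with vertex set Fin n.  Decidability of
-- adjacency is automatic classically and is part of what makes the graph a
-- finite object constructively.
record Graph (n : ℕ) : Set₁ where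
  field
    Adj    : Rel (Fin n) 0ℓ
    adj?   : B.Decidable Adj
    symm   : ∀ {u v} → Adj u v → Adj v u
    irrefl : ∀ {v} → ¬ Adj v v

open Graph public

private variable
  m n : ℕ

comap : (Fin m → Fin n) → Graph n → Graph m
comap f G .Adj u v  = Adj G (f u) (f v)
comap f G .adj? u v = adj? G (f u) (f v)
comap f G .symm     = symm G
comap f G .irrefl   = irrefl G

-- The increasing enumeration of the elements of S.
enum : (S : Subset n) → Fin ∣ S ∣ → Fin n
enum (inside  ∷ S) zero    = zero
enum (inside  ∷ S) (suc i) = suc (enum S i)
enum (outside ∷ S) i       = suc (enum S i)

-- The induced subgraph, its vertices renumbered along enum S.
infix 9 _[_]
_[_] : Graph n → (S : Subset n) → Graph ∣ S ∣
G [ S ] = comap (enum S) G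

IsClique : Graph n → Subset n → Set
IsClique G S = ∀ {u v} → u ∈ S → v ∈ S → u ≢ v → Adj G u v

IsIndependent : Graph n → Subset n → Set
IsIndependent G S = ∀ {u v} → u ∈ S → v ∈ S → ¬ Adj G u v

record IsCutPartition (G : Graph n) (A B C : Subset n) : Set where
  field
    A∩B-empty  : Empty (A ∩ B)
    A∩C-empty  : Empty (A ∩ C)
    B∩C-empty  : Empty (B ∩ C)
    cover      : A ∪ B ∪ C ≡ ⊤
    A-nonempty : Nonempty A
    B-nonempty : Nonempty B
    no-edges   : ∀ {a b} → a ∈ A → b ∈ B → ¬ Adj G a b

IsCliqueCutset : Graph n → Subset n → Set
IsCliqueCutset G C = IsClique G C × ∃ λ A → ∃ λ B → IsCutPartition G A B C

------------------------------------------------------------------------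

IsMinimum IsMaximum : ∀ {ℓ} → Pred ℕ ℓ → Pred ℕ ℓ
IsMinimum P k = P k × (∀ {j} → P j → k ≤ j)
IsMaximum P k = P k × (∀ {j} → P j → j ≤ k)

minimum : ∀ {ℓ} {P : Pred ℕ ℓ} → Decidable P → ∃ P → ∃ (IsMinimum P)
minimum {P = P} P? (b , Pb) = go P P? b Pb
  where
  go : ∀ {ℓ} (P : Pred ℕ ℓ) → Decidable P → ∀ b → P b → ∃ (IsMinimum P)
  go P P? b Pb with P? 0
  go P P? b       Pb | yes P0 = 0 , P0 , λ _ → z≤n
  go P P? zero    Pb | no ¬P0 = contradiction Pb ¬P0
  go P P? (suc b) Pb | no ¬P0 with go (P ∘ suc) (P? ∘ suc) b Pb
  ... | k , Pk , least = suc k , Pk , λ {j} → least′ j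
    where
    least′ : ∀ j → P j → suc k ≤ j
    least′ zero    P0 = contradiction P0 ¬P0
    least′ (suc j) Pj = s≤s (least Pj)

maximum : ∀ {ℓ} {P : Pred ℕ ℓ} → Decidable P → P 0 → ∀ b → (∀ {j} → P j → j ≤ b) → ∃ (IsMaximum P)
maximum P? P0 zero    bound = 0 , P0 , bound
maximum {P = P} P? P0 (suc b) bound with P? (suc b)
... | yes Pb = suc b , Pb , bound
... | no ¬Pb = maximum P? P0 b λ {j} Pj →
  ℕₚ.≤-pred (ℕₚ.≤∧≢⇒< (bound Pj) λ { refl → ¬Pb Pj })

------------------------------------------------------------------------

isIndependent? : (G : Graph n) → Decidable (IsIndependent G)
isIndependent? G S = Dec.map′ (λ f {u} {v} → f u v) (λ f u v → f {u} {v})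
  (Finₚ.all? λ u → Finₚ.all? λ v →
    (u Subₚ.∈? S) →-dec ((v Subₚ.∈? S) →-dec ¬? (adj? G u v)))

HasIndependentSetOfSize : Graph n → Pred ℕ 0ℓ
HasIndependentSetOfSize {n} G k = ∃ λ (S : Subset n) → IsIndependent G S × ∣ S ∣ ≡ k

abstract
  private
    α-exists : (G : Graph n) → ∃ (IsMaximum (HasIndependentSetOfSize G))
    α-exists {n} G = maximum
      (λ k → Subₚ.anySubset? λ S → isIndependent? G S ×-dec (∣ S ∣ ℕₚ.≟ k))
      (⊥ , (λ u∈⊥ → contradiction u∈⊥ Subₚ.∉⊥) , Subₚ.∣⊥∣≡0 n)
      n
      λ { (S , _ , refl) → Subₚ.∣p∣≤n S }

  -- Characterised by α-isMaximum below.
  α : Graph n → ℕ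
  α G = proj₁ (α-exists G)

  α-isMaximum : (G : Graph n) → IsMaximum (HasIndependentSetOfSize G) (α G)
  α-isMaximum G = proj₂ (α-exists G)

------------------------------------------------------------------------

-- Any two vertices are joined by a walk; also satisfied by the null graph.
Connected : Graph n → Set
Connected G = ∀ u v → Star (Adj G) u v

-- The cycle x, x₁, …, xₖ, x, where xs = x₁, …, xₖ and k ≥ 2.
record Cycle (G : Graph n) : Set where
  field
    x        : Fin n
    xs       : List (Fin n)
    length≥2 : 2 ≤ length xs
    distinct : Unique (x ∷ xs)
    closed   : Linked (Adj G) (x ∷ (xs ∷ʳ x))

record IsTree (T : Graph n) : Set where
  field
    nonempty  : Fin n
    connected : Connected T
    acyclic   : ¬ Cycle T

record TreeDecomposition (G : Graph n) : Set₁ where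
  field
    {size} : ℕ
    T      : Graph size
    isTree : IsTree T
    bag    : Fin size → Subset n

  -- {t ∣ u ∈ bag t}
  nodes : Fin n → Subset size
  nodes u = tabulate λ t → lookup (bag t) u

  field
    vertices-covered : ∀ v → ∃ λ t → v ∈ bag t
    edges-covered    : ∀ {u v} → Adj G u v → ∃ λ t → u ∈ bag t × v ∈ bag t
    nodes-connected  : ∀ u → Connected (T [ nodes u ])

-- The maximum of α (G [ bag t ]); the seed 0 is harmless as T has a node.
α-decomposition : {G : Graph n} → TreeDecomposition G → ℕ
α-decomposition {G = G} 𝒯 = Vector.foldr _⊔_ 0 λ t → α (G [ bag t ])
  where open TreeDecomposition 𝒯

HasTreeDecompositionOfα : Graph n → Pred ℕ _
HasTreeDecompositionOfα G k = Σ (TreeDecomposition G) λ 𝒯 → α-decomposition 𝒯 ≡ k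

------------------------------------------------------------------------
-- The minimum of α-decomposition over the (infinitely many) tree
-- decompositions exists constructively.  The rest of this file proves this:
-- whether some decomposition has all bags of independence number at most k
-- is decided by searching for a vertex elimination order.

-- Connectivity of {t ∣ Q t} in T, phrased without renumbering.
Within : Graph m → Pred (Fin m) 0ℓ → Rel (Fin m) 0ℓ
Within T Q s t = Adj T s t × Q s × Q t

ConnectedOn : Graph m → Pred (Fin m) 0ℓ → Set
ConnectedOn T Q = ∀ {s t} → Q s → Q t → Star (Within T Q) s t

enum-∈ : (S : Subset n) (i : Fin ∣ S ∣) → enum S i ∈ S
enum-∈ (inside  ∷ S) zero    = here
enum-∈ (inside  ∷ S) (suc i) = there (enum-∈ S i)
enum-∈ (outside ∷ S) i       = there (enum-∈ S i)

index : (S : Subset n) {v : Fin n} → v ∈ S → Fin ∣ S ∣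
index (inside  ∷ S) here      = zero
index (inside  ∷ S) (there p) = suc (index S p)
index (outside ∷ S) (there p) = index S p

enum-index : (S : Subset n) {v : Fin n} (p : v ∈ S) → enum S (index S p) ≡ v
enum-index (inside  ∷ S) here      = refl
enum-index (inside  ∷ S) (there p) = cong suc (enum-index S p)
enum-index (outside ∷ S) (there p) = cong suc (enum-index S p)

enum-injective : (S : Subset n) {i j : Fin ∣ S ∣} → enum S i ≡ enum S j → i ≡ j
enum-injective (inside  ∷ S) {zero}  {zero}  eq = refl
enum-injective (inside  ∷ S) {suc i} {suc j} eq = cong suc (enum-injective S (Finₚ.suc-injective eq))
enum-injective (outside ∷ S) eq = enum-injective S (Finₚ.suc-injective eq)

connected⇒connectedOn : (T : Graph m) (S : Subset m) → Connected (T [ S ]) → ConnectedOn T (_∈ S)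
connected⇒connectedOn T S conn p q =
  subst (λ z → Star _ z _) (enum-index S p)
    (subst (Star _ _) (enum-index S q)
      (Star.gmap (enum S) (λ {i} {j} e → e , enum-∈ S i , enum-∈ S j)
        (conn (index S p) (index S q))))

connectedOn⇒connected : (T : Graph m) (S : Subset m) → ConnectedOn T (_∈ S) → Connected (T [ S ])
connectedOn⇒connected T S conn i j = go i (conn (enum-∈ S i) (enum-∈ S j)) refl
  where
  go : ∀ i {s} → Star (Within T (_∈ S)) s (enum S j) → s ≡ enum S i → Star (Adj (T [ S ])) i j
  go i ε eq = subst (Star _ i) (enum-injective S (sym eq)) ε
  go i ((e , _ , q) ◅ w) refl =
    subst (Adj T (enum S i)) (sym (enum-index S q)) e ◅ go (index S q) w (sym (enum-index S q))

∈-tabulate⁺ : (f : Fin n → _) {v : Fin n} → f v ≡ inside → v ∈ tabulate f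
∈-tabulate⁺ f {v} eq = Vecₚ.lookup⇒[]= v _ (trans (Vecₚ.lookup∘tabulate f v) eq)

∈-tabulate⁻ : (f : Fin n → _) {v : Fin n} → v ∈ tabulate f → f v ≡ inside
∈-tabulate⁻ f {v} p = trans (sym (Vecₚ.lookup∘tabulate f v)) (Vecₚ.[]=⇒lookup p)

connectedOn-resp : {T : Graph m} {P Q : Pred (Fin m) 0ℓ} →
                   (∀ {t} → P t → Q t) → (∀ {t} → Q t → P t) → ConnectedOn T P → ConnectedOn T Q
connectedOn-resp f g conn p q = Star.map (λ (e , a , b) → e , f a , f b) (conn (g p) (g q))

module _ {G : Graph n} (𝒯 : TreeDecomposition G) where
  open TreeDecomposition 𝒯

  ∈-nodes⁺ : ∀ {u t} → u ∈ bag t → t ∈ nodes u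
  ∈-nodes⁺ p = ∈-tabulate⁺ _ (Vecₚ.[]=⇒lookup p)

  ∈-nodes⁻ : ∀ {u t} → t ∈ nodes u → u ∈ bag t
  ∈-nodes⁻ {u} {t} p = Vecₚ.lookup⇒[]= u (bag t) (∈-tabulate⁻ _ p)

  nodes-connectedOn : ∀ u → ConnectedOn T (λ t → u ∈ bag t)
  nodes-connectedOn u = connectedOn-resp {T = T} ∈-nodes⁻ ∈-nodes⁺
    (connected⇒connectedOn T (nodes u) (nodes-connected u))

------------------------------------------------------------------------

IsLeaf : Graph m → (ℓ a : Fin m) → Set
IsLeaf T ℓ a = Adj T ℓ a × (∀ {b} → Adj T ℓ b → b ≡ a)

Unique⇒length≤ : {xs : List (Fin n)} → Unique xs → length xs ≤ n
Unique⇒length≤ {xs = xs} u = Finₚ.injective⇒≤ {f = List.lookup xs} (lookup-injective u)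
  where
  lookup-injective : ∀ {xs : List (Fin n)} → Unique xs → ∀ {i j} → List.lookup xs i ≡ List.lookup xs j → i ≡ j
  lookup-injective (_  ∷ _) {zero}  {zero}  eq = refl
  lookup-injective (px ∷ _) {zero}  {suc j} eq = contradiction eq (All.lookup px (Memₚ.∈-lookup j))
  lookup-injective (px ∷ _) {suc i} {zero}  eq = contradiction (sym eq) (All.lookup px (Memₚ.∈-lookup i))
  lookup-injective (_  ∷ u) {suc i} {suc j} eq = cong suc (lookup-injective u eq)

module _ (T : Graph m) where

  private
    -- The prefix of zs ending in b, closed up by x.
    cut : ∀ {b x y zs} → b ∈ₗ zs → Adj T b x → Linked (Adj T) (y ∷ zs) →
          ∃ λ k → 1 ≤ length (List.take k zs) × Linked (Adj T) (y ∷ (List.take k zs ∷ʳ x))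
    cut (here refl) e (d ∷ _) = 1 , s≤s z≤n , d ∷ e ∷ [-]
    cut (there p)   e (d ∷ L) with cut p e L
    ... | k , _ , L′ = suc k , s≤s z≤n , d ∷ L′

    search : ¬ Cycle T → ∀ fuel x y zs → m < fuel + length (x ∷ y ∷ zs) →
             Unique (x ∷ y ∷ zs) → Linked (Adj T) (x ∷ y ∷ zs) → ∃ λ ℓ → ∃ λ a → IsLeaf T ℓ a
    search ac zero x y zs lt u L = contradiction (Unique⇒length≤ u) (ℕₚ.<⇒≱ lt)
    search ac (suc fuel) x y zs lt u L@(e ∷ L′)
      with Finₚ.any? (λ b → adj? T x b ×-dec ¬? (b Finₚ.≟ y))
    ... | no none = x , y , e , λ {b} d → decidable-stable (b Finₚ.≟ y) λ b≢y → none (b , d , b≢y)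
    ... | yes (b , d , b≢y) with DecMem._∈?_ Finₚ._≟_ b zs
    ...   | no b∉zs = search ac fuel b x (y ∷ zs)
              (subst (m <_) (sym (ℕₚ.+-suc fuel _)) lt)
              (((λ { refl → irrefl T d }) ∷ b≢y ∷ Allₚ.¬Any⇒All¬ zs b∉zs) ∷ u)
              (symm T d ∷ L)
    ...   | yes b∈zs with cut b∈zs (symm T d) L′
    ...     | k , 1≤ , L″ = ⊥-elim (ac record
                { x = x ; xs = y ∷ List.take k zs ; length≥2 = s≤s 1≤
                ; distinct = AllPairsₚ.take⁺ (suc (suc k)) u ; closed = e ∷ L″ })

  leaf-exists : IsTree T → ∀ {u v : Fin m} → u ≢ v → ∃ λ ℓ → ∃ λ a → IsLeaf T ℓ a
  leaf-exists tree {u} {v} u≢v with IsTree.connected tree u v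
  ... | ε = contradiction refl u≢v
  ... | _◅_ {j = b} e _ = search (IsTree.acyclic tree) m b u []
          (ℕₚ.m<m+n m (s≤s z≤n))
          (((λ { refl → irrefl T e }) ∷ []) ∷ [] ∷ []) (symm T e ∷ [-])

  leaf-neighbour : ∀ {Q : Pred (Fin m) 0ℓ} {ℓ a t} → IsLeaf T ℓ a → ConnectedOn T Q →
                   Q ℓ → Q t → t ≢ ℓ → Q a
  leaf-neighbour (_ , only) conn qℓ qt t≢ℓ with conn qℓ qt
  ... | ε = contradiction refl t≢ℓ
  ... | (e , _ , qb) ◅ _ = subst _ (only e) qb

connected⇒connectedOn-⊤ : (T : Graph m) → Connected T → ConnectedOn T (λ _ → ⊤₀)
connected⇒connectedOn-⊤ T conn {s} {t} _ _ = Star.map (λ e → e , _ , _) (conn s t)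

cycle-map : {T : Graph m} {T′ : Graph n} (f : Fin m → Fin n) → (∀ {u v} → f u ≡ f v → u ≡ v) →
            (∀ {u v} → Adj T u v → Adj T′ (f u) (f v)) → Cycle T → Cycle T′
cycle-map f inj hom c = record
  { x = f x ; xs = List.map f xs
  ; length≥2 = subst (2 ≤_) (sym (Listₚ.length-map f xs)) length≥2
  ; distinct = Uniqueₚ.map⁺ inj distinct
  ; closed = subst (Linked _) (cong (f x ∷_) (Listₚ.map-++ f xs (x ∷ [])))
               (Linkedₚ.map⁺ (Linked.map hom closed)) }
  where open Cycle c

module _ (T : Graph (suc m)) {ℓ a : Fin (suc m)} (leaf : IsLeaf T ℓ a) where

  removeLeaf : Graph m
  removeLeaf = comap (punchIn ℓ) T

  private
    ℓ≢a : ℓ ≢ a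
    ℓ≢a refl = irrefl T (proj₁ leaf)

    collapse : Fin (suc m) → Fin m
    collapse x with ℓ Finₚ.≟ x
    ... | yes _   = punchOut ℓ≢a
    ... | no  ℓ≢x = punchOut ℓ≢x

    collapse-a : collapse a ≡ punchOut ℓ≢a
    collapse-a with ℓ Finₚ.≟ a
    ... | yes _ = refl
    ... | no  _ = Finₚ.punchOut-cong ℓ refl

    collapse-ℓ : collapse ℓ ≡ punchOut ℓ≢a
    collapse-ℓ with ℓ Finₚ.≟ ℓ
    ... | yes _ = refl
    ... | no ne = contradiction refl ne

    collapse-punchIn : ∀ x → collapse (punchIn ℓ x) ≡ x
    collapse-punchIn x with ℓ Finₚ.≟ punchIn ℓ x
    ... | yes eq = contradiction (sym eq) (Finₚ.punchInᵢ≢i ℓ x)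
    ... | no  _  = trans (Finₚ.punchOut-cong ℓ refl) (Finₚ.punchOut-punchIn ℓ)

    punchIn-collapse : ∀ {x} → ℓ ≢ x → punchIn ℓ (collapse x) ≡ x
    punchIn-collapse {x} ne with ℓ Finₚ.≟ x
    ... | yes eq = contradiction eq ne
    ... | no ℓ≢x = Finₚ.punchIn-punchOut ℓ≢x

  removeLeaf-connectedOn : ∀ {Q} → ConnectedOn T Q → ConnectedOn removeLeaf (Q ∘ punchIn ℓ)
  removeLeaf-connectedOn {Q} conn {s} {t} qs qt =
    subst (λ z → Star _ z t) (collapse-punchIn s)
      (subst (Star _ _) (collapse-punchIn t) (go (conn qs qt)))
    where
    R = Star (Within removeLeaf (Q ∘ punchIn ℓ))
    go : ∀ {x y} → Star (Within T Q) x y → R (collapse x) (collapse y)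
    go ε = ε
    go {y = y} (_◅_ {i = x} {j = z} (e , qx , qz) w) with ℓ Finₚ.≟ x | ℓ Finₚ.≟ z
    ... | yes refl | _ = subst (λ c → R c (collapse y))
            (trans (cong collapse (proj₂ leaf e)) (trans collapse-a (Finₚ.punchOut-cong ℓ refl)))
            (go w)
    ... | no ℓ≢x | yes refl = subst (λ c → R c (collapse y))
            (trans collapse-ℓ (Finₚ.punchOut-cong ℓ (sym (proj₂ leaf (symm T e))))) (go w)
    ... | no ℓ≢x | no ℓ≢z =
      (subst (λ c → Adj T c (punchIn ℓ (collapse z))) (sym eqx)
         (subst (Adj T x) (sym eqz) e) , subst Q (sym eqx) qx , subst Q (sym eqz) qz) ◅ go w
      where
      eqx = Finₚ.punchIn-punchOut ℓ≢x
      eqz = punchIn-collapse ℓ≢z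

  removeLeaf-isTree : IsTree T → IsTree removeLeaf
  removeLeaf-isTree tree = record
    { nonempty  = punchOut ℓ≢a
    ; connected = λ s t → Star.map proj₁
        (removeLeaf-connectedOn (connected⇒connectedOn-⊤ T (IsTree.connected tree)) {s} {t} _ _)
    ; acyclic   = λ c → IsTree.acyclic tree
        (cycle-map {T = removeLeaf} {T′ = T} (punchIn ℓ) (Finₚ.punchIn-injective ℓ _ _) id c)
    }

------------------------------------------------------------------------

module _ (T : Graph m) (a : Fin m) where

  addLeaf : Graph (suc m)
  addLeaf .Adj zero    zero    = ⊥₀
  addLeaf .Adj zero    (suc j) = j ≡ a
  addLeaf .Adj (suc i) zero    = i ≡ a
  addLeaf .Adj (suc i) (suc j) = Adj T i j
  addLeaf .adj? zero    zero    = no λ ()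
  addLeaf .adj? zero    (suc j) = j Finₚ.≟ a
  addLeaf .adj? (suc i) zero    = i Finₚ.≟ a
  addLeaf .adj? (suc i) (suc j) = adj? T i j
  addLeaf .symm {zero}  {suc j} e = e
  addLeaf .symm {suc i} {zero}  e = e
  addLeaf .symm {suc i} {suc j} e = symm T e
  addLeaf .irrefl {suc i} e = irrefl T e

  addLeaf-connectedOn : ∀ {Q} → ConnectedOn T (Q ∘ suc) →
                        (∀ {t} → Q zero → Q (suc t) → Q (suc a)) → ConnectedOn addLeaf Q
  addLeaf-connectedOn {Q} conn reach {s} {t} = go s t
    where
    old : ∀ {s t} → Q (suc s) → Q (suc t) → Star (Within addLeaf Q) (suc s) (suc t)
    old q q′ = Star.gmap suc id (conn q q′)
    go : ∀ s t → Q s → Q t → Star (Within addLeaf Q) s t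
    go zero    zero    q q′ = ε
    go zero    (suc t) q q′ = let qa = reach q q′ in (refl , q , qa) ◅ old qa q′
    go (suc s) zero    q q′ = let qa = reach q′ q in old q qa ◅◅ ((refl , qa , q′) ◅ ε)
    go (suc s) (suc t) q q′ = old q q′

  private
    zero-isLeaf : ∀ {b} → Adj addLeaf zero b → b ≡ suc a
    zero-isLeaf {suc _} refl = refl

    sucs : (xs : List (Fin (suc m))) → zero ∉ₗ xs → ∃ λ ys → xs ≡ List.map suc ys
    sucs []           _ = [] , refl
    sucs (zero  ∷ xs) z = contradiction (here refl) z
    sucs (suc x ∷ xs) z with sucs xs (z ∘ there)
    ... | ys , refl = x ∷ ys , refl

    last-adj : ∀ y ys {x} → Linked (Adj addLeaf) (y ∷ (ys ∷ʳ x)) → ∃ λ p → p ∈ₗ y ∷ ys × Adj addLeaf p x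
    last-adj y []       (e ∷ [-]) = y , here refl , e
    last-adj y (z ∷ ys) (_ ∷ L) with last-adj z ys L
    ... | p , p∈ , e = p , there p∈ , e

    zero-not-start : ∀ xs → 2 ≤ length xs → Unique xs → ¬ Linked (Adj addLeaf) (zero ∷ (xs ∷ʳ zero))
    zero-not-start (y ∷ []) (s≤s ()) _ _
    zero-not-start (y ∷ z ∷ zs) _ (py ∷ _) (e ∷ _ ∷ L) with last-adj z zs L
    ... | p , p∈ , d = All.lookup py p∈ (trans (zero-isLeaf e) (sym (zero-isLeaf (symm addLeaf {p} {zero} d))))

    zero-not-inside : ∀ p ys {x} → p ≢ x ⊎ 2 ≤ length ys → x ∉ₗ ys → Unique (p ∷ ys) →
                      Linked (Adj addLeaf) (p ∷ (ys ∷ʳ x)) → zero ∉ₗ ys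
    zero-not-inside p (_ ∷ []) (inj₂ (s≤s ())) x∉ u L (here refl)
    zero-not-inside p (_ ∷ []) (inj₁ p≢x) x∉ u (e ∷ d ∷ _) (here refl) =
      p≢x (trans (zero-isLeaf (symm addLeaf {p} {zero} e)) (sym (zero-isLeaf d)))
    zero-not-inside p (_ ∷ z ∷ zs) _ x∉ ((_ ∷ p≢z ∷ _) ∷ _) (e ∷ d ∷ _) (here refl) =
      p≢z (trans (zero-isLeaf (symm addLeaf {p} {zero} e)) (sym (zero-isLeaf d)))
    zero-not-inside p (y ∷ ys) _ x∉ (_ ∷ u) (_ ∷ L) (there z∈) =
      zero-not-inside y ys (inj₁ λ { refl → x∉ (here refl) }) (x∉ ∘ there) u L z∈

  addLeaf-acyclic : ¬ Cycle T → ¬ Cycle addLeaf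
  addLeaf-acyclic ac record { x = zero ; xs = xs ; length≥2 = l ; distinct = _ ∷ u ; closed = L } =
    zero-not-start xs l u L
  addLeaf-acyclic ac record { x = suc x ; xs = xs ; length≥2 = l ; distinct = u@(px ∷ _) ; closed = L }
    with sucs xs (zero-not-inside (suc x) xs (inj₂ l) (λ x∈ → All.lookup px x∈ refl) u L)
  ... | ys , refl = ac record
    { x = x ; xs = ys
    ; length≥2 = subst (2 ≤_) (Listₚ.length-map suc ys) l
    ; distinct = Uniqueₚ.map⁻ u
    ; closed = Linkedₚ.map⁻ (subst (Linked _) (cong (suc x ∷_) (sym (Listₚ.map-++ suc ys (x ∷ [])))) L)
    }

  addLeaf-isTree : IsTree T → IsTree addLeaf
  addLeaf-isTree tree = record
    { nonempty  = zero
    ; connected = λ s t → Star.map proj₁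
        (addLeaf-connectedOn {Q = λ _ → ⊤₀} (connected⇒connectedOn-⊤ T (IsTree.connected tree)) _ {s} {t} _ _)
    ; acyclic   = addLeaf-acyclic (IsTree.acyclic tree)
    }

singleNode : Graph 1
singleNode .Adj _ _  = ⊥₀
singleNode .adj? _ _ = no λ ()
singleNode .symm ()
singleNode .irrefl ()

singleNode-isTree : IsTree singleNode
singleNode-isTree = record
  { nonempty  = zero
  ; connected = λ { zero zero → ε }
  ; acyclic   = λ where
      record { xs = [] ; length≥2 = () }
      record { xs = _ ∷ _ ; closed = () ∷ _ }
  }

------------------------------------------------------------------------
-- Helly property: a set of vertices that pairwise share bags lies in a bag.

private
  Helly : ℕ → ℕ → Set₁
  Helly m n = (T : Graph m) → IsTree T → (X : Fin m → Subset n) →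
    (∀ u → ConnectedOn T (λ t → u ∈ X t)) → (K : Subset n) →
    (∀ {u v} → u ∈ K → v ∈ K → ∃ λ t → u ∈ X t × v ∈ X t) → ∃ λ t → K ⊆ X t

  helly-step : Helly (suc m) n → Helly (suc (suc m)) n
  helly-step ih T tree X conn K share
    with ℓ , a , leaf ← leaf-exists T tree {zero} {suc zero} (λ ())
    with Subₚ._⊆?_ K (X ℓ)
  ... | yes K⊆ = ℓ , K⊆
  ... | no K⊈ = let t , K⊆ = rec in punchIn ℓ t , K⊆
    where
    outlier : ∃ λ c → c ∈ K × c ∉ X ℓ
    outlier with Finₚ.any? (λ c → (c Subₚ.∈? K) ×-dec ¬? (c Subₚ.∈? X ℓ))
    ... | yes w = w
    ... | no none = contradiction
            (λ {c} c∈K → decidable-stable (c Subₚ.∈? X ℓ) λ c∉ → none (c , c∈K , c∉)) K⊈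

    in-a : ∀ {u} → u ∈ K → u ∈ X ℓ → u ∈ X a
    in-a {u} u∈K u∈ℓ with c , c∈K , c∉ ← outlier with share u∈K c∈K
    ... | t , u∈t , c∈t = leaf-neighbour T {Q = λ t → u ∈ X t} leaf (conn u) u∈ℓ u∈t λ { refl → c∉ c∈t }

    ℓ≢a : ℓ ≢ a
    ℓ≢a refl = irrefl T (proj₁ leaf)

    share′ : ∀ {u v} → u ∈ K → v ∈ K → ∃ λ t → u ∈ X (punchIn ℓ t) × v ∈ X (punchIn ℓ t)
    share′ {u} {v} u∈K v∈K with share u∈K v∈K
    ... | t , u∈t , v∈t with ℓ Finₚ.≟ t
    ...   | no ℓ≢t = punchOut ℓ≢t , subst (λ z → u ∈ X z × v ∈ X z) (sym (Finₚ.punchIn-punchOut ℓ≢t)) (u∈t , v∈t)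
    ...   | yes refl = punchOut ℓ≢a , subst (λ z → u ∈ X z × v ∈ X z) (sym (Finₚ.punchIn-punchOut ℓ≢a))
                         (in-a u∈K u∈t , in-a v∈K v∈t)

    rec = ih (removeLeaf T leaf) (removeLeaf-isTree T leaf tree) (X ∘ punchIn ℓ)
         (λ u → removeLeaf-connectedOn T leaf {Q = λ t → u ∈ X t} (conn u)) K share′

helly : ∀ {m n} → Helly m n
helly {zero} T tree X conn K share = contradiction (IsTree.nonempty tree) λ ()
helly {suc zero} T tree X conn K share = zero , λ u∈K → in-zero (share u∈K u∈K)
  where
  in-zero : ∀ {u} → (∃ λ t → u ∈ X t × u ∈ X t) → u ∈ X zero
  in-zero (zero , p , _) = p
helly {suc (suc m)} = helly-step helly

------------------------------------------------------------------------

-- The pairs of vertices that have to share a bag.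
record Requirement (n : ℕ) : Set₁ where
  field
    Req     : Rel (Fin n) 0ℓ
    req?    : B.Decidable Req
    reflReq : ∀ {u} → Req u u
    symReq  : ∀ {u v} → Req u v → Req v u

open Requirement

fill : Requirement n → Fin n → Requirement n
fill R v .Req u w  = Req R u w ⊎ (Req R v u × Req R v w)
fill R v .req? u w = req? R u w ⊎-dec (req? R v u ×-dec req? R v w)
fill R v .reflReq  = inj₁ (reflReq R)
fill R v .symReq (inj₁ r)       = inj₁ (symReq R r)
fill R v .symReq (inj₂ (r , s)) = inj₂ (s , r)

closedNbhd : Subset n → Requirement n → Fin n → Subset n
closedNbhd S R v = S ∩ tabulate (λ u → Dec.⌊ req? R v u ⌋)

module _ {S : Subset n} {R : Requirement n} {v : Fin n} where
  ∈-closedNbhd⁺ : ∀ {u} → u ∈ S → Req R v u → u ∈ closedNbhd S R v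
  ∈-closedNbhd⁺ {u} u∈S r = Subₚ.x∈p∩q⁺ (u∈S , ∈-tabulate⁺ _ (isYes (req? R v u) r))
    where
    isYes : ∀ {A : Set} (d : Dec A) → A → Dec.⌊ d ⌋ ≡ inside
    isYes (yes _) _ = refl
    isYes (no ¬a) a = contradiction a ¬a

  ∈-closedNbhd⁻ : ∀ {u} → u ∈ closedNbhd S R v → u ∈ S × Req R v u
  ∈-closedNbhd⁻ {u} p with Subₚ.x∈p∩q⁻ S _ p
  ... | u∈S , q = u∈S , holds (req? R v u) (∈-tabulate⁻ _ q)
    where
    holds : ∀ {A : Set} (d : Dec A) → Dec.⌊ d ⌋ ≡ inside → A
    holds (yes a) _ = a

∈-minus⁻ : {S : Subset n} {u v : Fin n} → u ∈ S - v → u ∈ S × u ≢ v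
∈-minus⁻ {S = S} {u} {v} p = Subₚ.p─q⊆p S _ p , λ { refl → go S u p }
  where
  go : ∀ {n} (S : Subset n) u → u ∉ S - u
  go (inside  ∷ S) zero    ()
  go (outside ∷ S) zero    ()
  go (_ ∷ S) (suc u) (there p) = go S u p

module _ (P : Pred (Subset n) 0ℓ) (P? : Decidable P) (P-⊆ : ∀ {X Y} → X ⊆ Y → P Y → P X) where

  record Decomposable (S : Subset n) (R : Requirement n) : Set₁ where
    constructor decomposition
    field
      {size} : ℕ
      T      : Graph size
      isTree : IsTree T
      X      : Fin size → Subset n
      X⊆S    : ∀ {t} → X t ⊆ S
      good   : ∀ t → P (X t)
      conn   : ∀ u → ConnectedOn T (λ t → u ∈ X t)
      covers : ∀ {u v} → u ∈ S → v ∈ S → Req R u v → ∃ λ t → u ∈ X t × v ∈ X t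

  Eliminable : ℕ → Subset n → Requirement n → Set
  Eliminable zero    S R = P S
  Eliminable (suc k) S R =
    P S ⊎ ∃ λ v → v ∈ S × P (closedNbhd S R v) × Eliminable k (S - v) (fill R v)

  eliminable? : ∀ k S R → Dec (Eliminable k S R)
  eliminable? zero    S R = P? S
  eliminable? (suc k) S R = P? S ⊎-dec Finₚ.any? λ v →
    (v Subₚ.∈? S) ×-dec (P? (closedNbhd S R v) ×-dec eliminable? k (S - v) (fill R v))

  private
    single : ∀ {S R} → P S → Decomposable S R
    single {S} PS = decomposition singleNode singleNode-isTree (λ _ → S) id (λ _ → PS)
      (λ { u {zero} {zero} _ _ → ε }) λ p q _ → zero , p , q

    extend : ∀ {S R v} → v ∈ S → P (closedNbhd S R v) → Decomposable (S - v) (fill R v) → Decomposable S R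
    extend {S} {R} {v} v∈S PN (decomposition {k} T tree X X⊆S good conn covers) =
      decomposition (addLeaf T t₀) (addLeaf-isTree T t₀ tree) X⁺
        (λ {t} → X⁺⊆S t) good⁺
        (λ u → addLeaf-connectedOn T t₀ {Q = λ t → u ∈ X⁺ t} (conn u) λ p q → proj₂ host (in-host p q))
        covers⁺
      where
      N = closedNbhd S R v
      host : ∃ λ t → N - v ⊆ X t
      host = helly T tree X conn (N - v) λ p q →
        let p∈N , p≢v = ∈-minus⁻ p ; q∈N , q≢v = ∈-minus⁻ q
            p∈S , vp = ∈-closedNbhd⁻ {R = R} p∈N ; q∈S , vq = ∈-closedNbhd⁻ {R = R} q∈N
        in covers (Subₚ.x∈p∧x≢y⇒x∈p-y p∈S p≢v) (Subₚ.x∈p∧x≢y⇒x∈p-y q∈S q≢v) (inj₂ (vp , vq))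
      t₀ = proj₁ host
      X⁺ : Fin (suc k) → Subset n
      X⁺ zero    = N
      X⁺ (suc t) = X t
      X⁺⊆S : ∀ t → X⁺ t ⊆ S
      X⁺⊆S zero    p = proj₁ (∈-closedNbhd⁻ {R = R} p)
      X⁺⊆S (suc t) p = proj₁ (∈-minus⁻ (X⊆S p))
      good⁺ : ∀ t → P (X⁺ t)
      good⁺ zero    = PN
      good⁺ (suc t) = good t
      in-host : ∀ {u t} → u ∈ N → u ∈ X t → u ∈ N - v
      in-host p q = Subₚ.x∈p∧x≢y⇒x∈p-y p (proj₂ (∈-minus⁻ (X⊆S q)))
      covers⁺ : ∀ {u w} → u ∈ S → w ∈ S → Req R u w → ∃ λ t → u ∈ X⁺ t × w ∈ X⁺ t
      covers⁺ {u} {w} u∈S w∈S r with u Finₚ.≟ v | w Finₚ.≟ v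
      ... | yes refl | _ = zero , ∈-closedNbhd⁺ {R = R} u∈S (reflReq R) , ∈-closedNbhd⁺ {R = R} w∈S r
      ... | no _ | yes refl = zero , ∈-closedNbhd⁺ {R = R} u∈S (symReq R r) , ∈-closedNbhd⁺ {R = R} w∈S (reflReq R)
      ... | no u≢v | no w≢v with covers (Subₚ.x∈p∧x≢y⇒x∈p-y u∈S u≢v) (Subₚ.x∈p∧x≢y⇒x∈p-y w∈S w≢v) (inj₁ r)
      ...   | t , p , q = suc t , p , q

  eliminable⇒decomposable : ∀ k {S R} → Eliminable k S R → Decomposable S R
  eliminable⇒decomposable zero    PS        = single PS
  eliminable⇒decomposable (suc k) (inj₁ PS) = single PS
  eliminable⇒decomposable (suc k) (inj₂ (v , v∈S , PN , E)) =
    extend v∈S PN (eliminable⇒decomposable k E)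

  private
    P-S : ∀ k {S R} → P S → Eliminable k S R
    P-S zero    PS = PS
    P-S (suc k) PS = inj₁ PS

    Elim : ℕ → ℕ → Set₁
    Elim k m = ∀ {S R} → ∣ S ∣ ≤ k → (D : Decomposable S R) → Decomposable.size D ≡ m → Eliminable k S R

    elim-step : ∀ {k m S R} → Elim (suc k) (suc m) → (∀ m → Elim k m) →
      ∣ S ∣ ≤ suc k → (D : Decomposable S R) → Decomposable.size D ≡ suc (suc m) → Eliminable (suc k) S R
    elim-step {S = S} {R} ih₁ ih₂ le (decomposition T tree X X⊆S good conn covers) refl
      with ℓ , a , leaf ← leaf-exists T tree {zero} {suc zero} (λ ())
      with Finₚ.any? (λ v → (v Subₚ.∈? X ℓ) ×-dec ¬? (v Subₚ.∈? X a))
    ... | no none = ih₁ le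
          (decomposition (removeLeaf T leaf) (removeLeaf-isTree T leaf tree) (X ∘ punchIn ℓ) X⊆S
            (good ∘ punchIn ℓ)
            (λ u → removeLeaf-connectedOn T leaf {Q = λ t → u ∈ X t} (conn u)) covers′) refl
      where
      ℓ≢a : ℓ ≢ a
      ℓ≢a refl = irrefl T (proj₁ leaf)
      in-a : ∀ {u} → u ∈ X ℓ → u ∈ X a
      in-a {u} p = decidable-stable (u Subₚ.∈? X a) λ u∉ → none (u , p , u∉)
      covers′ : ∀ {u v} → u ∈ S → v ∈ S → Req R u v → ∃ λ t → u ∈ X (punchIn ℓ t) × v ∈ X (punchIn ℓ t)
      covers′ {u} {v} u∈S v∈S r with covers u∈S v∈S r
      ... | t , p , q with ℓ Finₚ.≟ t
      ...   | no ℓ≢t = punchOut ℓ≢t , subst (λ z → u ∈ X z × v ∈ X z) (sym (Finₚ.punchIn-punchOut ℓ≢t)) (p , q)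
      ...   | yes refl = punchOut ℓ≢a , subst (λ z → u ∈ X z × v ∈ X z) (sym (Finₚ.punchIn-punchOut ℓ≢a)) (in-a p , in-a q)
    ... | yes (v , v∈ℓ , v∉a) = inj₂ (v , v∈S , P-⊆ N⊆Xℓ (good ℓ) ,
          ih₂ _ (ℕₚ.≤-pred (ℕₚ.<-≤-trans (Subₚ.x∈p⇒∣p-x∣<∣p∣ v∈S) le))
            (decomposition T tree (λ t → X t - v)
              (λ p → let q , ne = ∈-minus⁻ p in Subₚ.x∈p∧x≢y⇒x∈p-y (X⊆S q) ne)
              (λ t → P-⊆ (proj₁ ∘ ∈-minus⁻) (good t)) conn′ covers′) refl)
      where
      v∈S = X⊆S v∈ℓ
      nbr∈Xℓ : ∀ {u} → u ∈ S → Req R v u → u ∈ X ℓ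
      nbr∈Xℓ {u} u∈S r with covers v∈S u∈S r
      ... | t , v∈t , u∈t with t Finₚ.≟ ℓ
      ...   | yes refl = u∈t
      ...   | no t≢ℓ = contradiction (leaf-neighbour T {Q = λ t → v ∈ X t} leaf (conn v) v∈ℓ v∈t t≢ℓ) v∉a
      N⊆Xℓ : closedNbhd S R v ⊆ X ℓ
      N⊆Xℓ p = let u∈S , r = ∈-closedNbhd⁻ {R = R} p in nbr∈Xℓ u∈S r
      conn′ : ∀ u → ConnectedOn T (λ t → u ∈ X t - v)
      conn′ u p q = connectedOn-resp {T = T} (λ r → Subₚ.x∈p∧x≢y⇒x∈p-y r u≢v) (proj₁ ∘ ∈-minus⁻) (conn u) p q
        where u≢v = proj₂ (∈-minus⁻ p)
      covers′ : ∀ {u w} → u ∈ S - v → w ∈ S - v → Req (fill R v) u w → ∃ λ t → u ∈ X t - v × w ∈ X t - v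
      covers′ {u} {w} p q r = let t , a , b = shared r in
          t , Subₚ.x∈p∧x≢y⇒x∈p-y a (proj₂ (∈-minus⁻ p)) , Subₚ.x∈p∧x≢y⇒x∈p-y b (proj₂ (∈-minus⁻ q))
        where
        shared : Req (fill R v) u w → ∃ λ t → u ∈ X t × w ∈ X t
        shared (inj₁ r)       = covers (proj₁ (∈-minus⁻ p)) (proj₁ (∈-minus⁻ q)) r
        shared (inj₂ (r , s)) = ℓ , nbr∈Xℓ (proj₁ (∈-minus⁻ p)) r , nbr∈Xℓ (proj₁ (∈-minus⁻ q)) s

    elim : ∀ k m → Elim k m
    elim k zero _ D refl = contradiction (IsTree.nonempty (Decomposable.isTree D)) λ ()
    elim k (suc zero) {S} {R} _ (decomposition T tree X X⊆S good conn covers) refl =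
      P-S k (P-⊆ (λ u∈S → in-zero (covers u∈S u∈S (reflReq R))) (good zero))
      where
      in-zero : ∀ {u} → (∃ λ t → u ∈ X t × u ∈ X t) → u ∈ X zero
      in-zero (zero , p , _) = p
    elim zero (suc (suc m)) {S} le (decomposition T tree X X⊆S good conn covers) refl =
      P-⊆ (λ {u} u∈S → contradiction (ℕₚ.<-≤-trans (Subₚ.x∈p⇒∣p-x∣<∣p∣ u∈S) le) λ ()) (good zero)
    elim (suc k) (suc (suc m)) = elim-step (elim (suc k) (suc m)) (elim k)

  decomposable? : ∀ S R → Dec (Decomposable S R)
  decomposable? S R = Dec.map′ (eliminable⇒decomposable ∣ S ∣) (λ D → elim ∣ S ∣ _ ℕₚ.≤-refl D refl)
    (eliminable? ∣ S ∣ S R)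

------------------------------------------------------------------------

embed : (X : Subset n) → Subset ∣ X ∣ → Subset n
embed []            S       = []
embed (inside  ∷ X) (b ∷ S) = b ∷ embed X S
embed (outside ∷ X) S       = outside ∷ embed X S

restrict : (X : Subset n) → Subset n → Subset ∣ X ∣
restrict []            S       = []
restrict (inside  ∷ X) (b ∷ S) = b ∷ restrict X S
restrict (outside ∷ X) (_ ∷ S) = restrict X S

∣embed∣ : (X : Subset n) (S : Subset ∣ X ∣) → ∣ embed X S ∣ ≡ ∣ S ∣
∣embed∣ []            []            = refl
∣embed∣ (inside  ∷ X) (inside  ∷ S) = cong suc (∣embed∣ X S)
∣embed∣ (inside  ∷ X) (outside ∷ S) = ∣embed∣ X S
∣embed∣ (outside ∷ X) S             = ∣embed∣ X S

∣restrict∣ : (X S : Subset n) → S ⊆ X → ∣ restrict X S ∣ ≡ ∣ S ∣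
∣restrict∣ []            []            _ = refl
∣restrict∣ (inside  ∷ X) (inside  ∷ S) p = cong suc (∣restrict∣ X S (Subₚ.drop-∷-⊆ p))
∣restrict∣ (inside  ∷ X) (outside ∷ S) p = ∣restrict∣ X S (Subₚ.drop-∷-⊆ p)
∣restrict∣ (outside ∷ X) (inside  ∷ S) p = contradiction (p here) λ ()
∣restrict∣ (outside ∷ X) (outside ∷ S) p = ∣restrict∣ X S (Subₚ.drop-∷-⊆ p)

∈-embed⁻ : (X : Subset n) (S : Subset ∣ X ∣) {v : Fin n} → v ∈ embed X S → ∃ λ i → i ∈ S × enum X i ≡ v
∈-embed⁻ (inside ∷ X) (_ ∷ S) here = zero , here , refl
∈-embed⁻ (inside ∷ X) (_ ∷ S) (there p) with ∈-embed⁻ X S p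
... | i , q , refl = suc i , there q , refl
∈-embed⁻ (outside ∷ X) S (there p) with ∈-embed⁻ X S p
... | i , q , refl = i , q , refl

∈-restrict⁻ : (X S : Subset n) {i : Fin ∣ X ∣} → i ∈ restrict X S → enum X i ∈ S
∈-restrict⁻ (inside  ∷ X) (_ ∷ S) here      = here
∈-restrict⁻ (inside  ∷ X) (_ ∷ S) (there p) = there (∈-restrict⁻ X S p)
∈-restrict⁻ (outside ∷ X) (_ ∷ S) p         = there (∈-restrict⁻ X S p)

module _ (G : Graph n) where

  α-induced-≥ : ∀ {X S} → S ⊆ X → IsIndependent G S → ∣ S ∣ ≤ α (G [ X ])
  α-induced-≥ {X} {S} S⊆X ind = proj₂ (α-isMaximum (G [ X ]))
    (restrict X S , (λ p q → ind (∈-restrict⁻ X S p) (∈-restrict⁻ X S q)) , ∣restrict∣ X S S⊆X)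

  α-induced-attained : ∀ X → ∃ λ S → S ⊆ X × IsIndependent G S × ∣ S ∣ ≡ α (G [ X ])
  α-induced-attained X with proj₁ (α-isMaximum (G [ X ]))
  ... | S , ind , eq = embed X S , S⊆X , ind′ , trans (∣embed∣ X S) eq
    where
    S⊆X : embed X S ⊆ X
    S⊆X p with i , _ , refl ← ∈-embed⁻ X S p = enum-∈ X i
    ind′ : IsIndependent G (embed X S)
    ind′ p q with i , i∈ , refl ← ∈-embed⁻ X S p | j , j∈ , refl ← ∈-embed⁻ X S q = ind i∈ j∈

  α-induced-mono : ∀ {X Y} → X ⊆ Y → α (G [ X ]) ≤ α (G [ Y ])
  α-induced-mono {X} X⊆Y with S , S⊆X , ind , eq ← α-induced-attained X =
    subst (_≤ _) eq (α-induced-≥ (X⊆Y ∘ S⊆X) ind)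

------------------------------------------------------------------------

max-upper : (f : Fin m → ℕ) (i : Fin m) → f i ≤ Vector.foldr _⊔_ 0 f
max-upper f zero    = ℕₚ.m≤m⊔n _ _
max-upper f (suc i) = ℕₚ.≤-trans (max-upper (f ∘ suc) i) (ℕₚ.m≤n⊔m (f zero) _)

max-least : (f : Fin m → ℕ) {k : ℕ} → (∀ i → f i ≤ k) → Vector.foldr _⊔_ 0 f ≤ k
max-least {zero}  f le = z≤n
max-least {suc m} f le = ℕₚ.⊔-lub (le zero) (max-least (f ∘ suc) (le ∘ suc))

module _ (G : Graph n) where

  private
    edgeRequirement : Requirement n
    edgeRequirement .Req u v  = u ≡ v ⊎ Adj G u v
    edgeRequirement .req? u v = (u Finₚ.≟ v) ⊎-dec adj? G u v
    edgeRequirement .reflReq  = inj₁ refl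
    edgeRequirement .symReq (inj₁ eq) = inj₁ (sym eq)
    edgeRequirement .symReq (inj₂ e)  = inj₂ (symm G e)

    D : ℕ → Set₁
    D k = Decomposable (λ X → α (G [ X ]) ≤ k) (λ X → α (G [ X ]) ℕₚ.≤? k)
            (λ p → ℕₚ.≤-trans (α-induced-mono G p)) ⊤ edgeRequirement

    D⇒decomposition : ∀ {k} → D k → Σ (TreeDecomposition G) λ 𝒯 → α-decomposition 𝒯 ≤ k
    D⇒decomposition d = 𝒯 , max-least _ good
      where
      open Decomposable d
      nodesX : Fin n → Subset size
      nodesX u = tabulate λ t → lookup (X t) u
      𝒯 : TreeDecomposition G
      𝒯 = record
        { T = T ; isTree = isTree ; bag = X
        ; vertices-covered = λ v → let t , p , _ = covers {v} Subₚ.∈⊤ Subₚ.∈⊤ (inj₁ refl) in t , p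
        ; edges-covered = λ e → covers Subₚ.∈⊤ Subₚ.∈⊤ (inj₂ e)
        ; nodes-connected = λ u → connectedOn⇒connected T (nodesX u)
            (connectedOn-resp {T = T}
              (λ p → ∈-tabulate⁺ _ (Vecₚ.[]=⇒lookup p))
              (λ {t} p → Vecₚ.lookup⇒[]= u (X t) (∈-tabulate⁻ _ p)) (conn u))
        }

    decomposition⇒D : ∀ {k} (𝒯 : TreeDecomposition G) → α-decomposition 𝒯 ≤ k → D k
    decomposition⇒D 𝒯 le = decomposition T isTree bag (λ _ → Subₚ.∈⊤)
      (λ t → ℕₚ.≤-trans (max-upper (λ t → α (G [ bag t ])) t) le) (nodes-connectedOn 𝒯)
      λ { {u} _ _ (inj₁ refl) → let t , p = vertices-covered u in t , p , p
        ; _ _ (inj₂ e) → edges-covered e }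
      where open TreeDecomposition 𝒯

  abstract
    private
      tree-α-exists : ∃ (IsMinimum (HasTreeDecompositionOfα G))
      tree-α-exists
        with k , Dk , least ← minimum {P = D} (λ k → decomposable? _ _ _ ⊤ edgeRequirement)
               (_ , eliminable⇒decomposable _ _ _ 0 ℕₚ.≤-refl)
        with 𝒯 , le ← D⇒decomposition Dk =
          k , (𝒯 , ℕₚ.≤-antisym le (least (decomposition⇒D 𝒯 ℕₚ.≤-refl))) ,
          λ { (𝒯′ , refl) → least (decomposition⇒D 𝒯′ ℕₚ.≤-refl) }

    -- Characterised by tree-α-isMinimum below.
    tree-α : ℕ
    tree-α = proj₁ tree-α-exists

    tree-α-isMinimum : IsMinimum (HasTreeDecompositionOfα G) tree-α
    tree-α-isMinimum = proj₂ tree-α-exists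

{-# OPTIONS --safe #-}

-- Restricting the bags of a tree decomposition of G to S decomposes G [ S ], so
-- tree-α is monotone under induced subgraphs, which gives ≥.  For ≤, the Helly
-- property puts the clique C into a single bag of any decomposition of G_A and
-- of G_B; joining two such bags by an edge yields a decomposition of G.  The
-- joined graph is a tree because no cycle uses a bridge.

module Submission where

open import Defs
open import Data.Nat.Base using (ℕ; _≤_; _+_; _⊔_; s≤s)
import Data.Nat.Properties as ℕₚ
open import Data.Fin.Base as Fin using (Fin; zero; suc; splitAt; _↑ˡ_; _↑ʳ_)
import Data.Fin.Properties as Finₚ
open import Data.Fin.Subset using (Subset; inside; outside; _∪_; _∩_; _∈_; _⊆_; ∣_∣)
import Data.Fin.Subset.Properties as Subₚ
open import Data.Vec.Base using (_∷_; here; there; lookup; tabulate)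
import Data.Vec.Properties as Vecₚ
open import Data.List.Base as List using (List; []; _∷_; _∷ʳ_)
import Data.List.Properties as Listₚ
open import Data.List.Membership.Propositional renaming (_∈_ to _∈ₗ_; _∉_ to _∉ₗ_)
import Data.List.Membership.Propositional.Properties as Memₚ
open import Data.List.Relation.Unary.All as All using (All; []; _∷_)
open import Data.List.Relation.Unary.AllPairs using ([]; _∷_)
open import Data.List.Relation.Unary.Any using (here; there)
open import Data.List.Relation.Unary.Linked using (Linked; [-]; _∷_)
import Data.List.Relation.Unary.Linked.Properties as Linkedₚ
open import Data.List.Relation.Unary.Unique.Propositional using (Unique)
import Data.List.Relation.Unary.Unique.Propositional.Properties as Uniqueₚ
open import Data.Product.Base using (Σ; ∃; _×_; _,_; proj₁; proj₂)
open import Data.Sum.Base as Sum using (_⊎_; inj₁; inj₂; [_,_]′)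
open import Data.Empty using (⊥-elim)
open import Data.Unit.Base using () renaming (⊤ to ⊤₀)
open import Function.Base using (_∘_; id)
open import Level using (0ℓ)
open import Relation.Nullary using (¬_; Dec; yes; no; contradiction)
open import Relation.Nullary.Decidable using (_×-dec_)
open import Relation.Unary using (Pred; Decidable)
open import Relation.Binary.Construct.Closure.ReflexiveTransitive using (Star; _◅_; _◅◅_)
import Relation.Binary.Construct.Closure.ReflexiveTransitive as Star
open import Relation.Binary.PropositionalEquality using (_≡_; _≢_; refl; sym; trans; cong; subst; subst₂)

private variable
  m n k : ℕ

-- Subsets of an induced subgraph

∈-embed⁺ : (X : Subset n) (S : Subset ∣ X ∣) {i : Fin ∣ X ∣} → i ∈ S → enum X i ∈ embed X S
∈-embed⁺ (inside  ∷ X) (_ ∷ S) here      = here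
∈-embed⁺ (inside  ∷ X) (_ ∷ S) (there p) = there (∈-embed⁺ X S p)
∈-embed⁺ (outside ∷ X) S       p         = there (∈-embed⁺ X S p)

∈-restrict⁺ : (X S : Subset n) {i : Fin ∣ X ∣} → enum X i ∈ S → i ∈ restrict X S
∈-restrict⁺ (inside  ∷ X) (_ ∷ S) {zero}  here      = here
∈-restrict⁺ (inside  ∷ X) (_ ∷ S) {suc i} (there p) = there (∈-restrict⁺ X S p)
∈-restrict⁺ (outside ∷ X) (_ ∷ S)         (there p) = ∈-restrict⁺ X S p

enum-∈-embed⁻ : (X : Subset n) (S : Subset ∣ X ∣) {i : Fin ∣ X ∣} → enum X i ∈ embed X S → i ∈ S
enum-∈-embed⁻ X S p with j , j∈S , eq ← ∈-embed⁻ X S p = subst (_∈ S) (enum-injective X eq) j∈S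

embed-⊆ : (X : Subset n) (S : Subset ∣ X ∣) → embed X S ⊆ X
embed-⊆ X S p with i , _ , refl ← ∈-embed⁻ X S p = enum-∈ X i

module _ (G : Graph n) (X : Subset n) where

  -- A maximum independent set `I` of `G` inside `embed X S` lies in `X`, so `restrict X` renumbers
  -- it without losing elements.
  α-embed : ∀ S → α (G [ embed X S ]) ≤ α ((G [ X ]) [ S ])
  α-embed S with I , I⊆ , ind , eq ← α-induced-attained G (embed X S) =
    subst (_≤ _) (trans (∣restrict∣ X I (embed-⊆ X S ∘ I⊆)) eq)
      (α-induced-≥ (G [ X ]) (enum-∈-embed⁻ X S ∘ I⊆ ∘ ∈-restrict⁻ X I)
        λ p q → ind (∈-restrict⁻ X I p) (∈-restrict⁻ X I q))

  -- `S` may reach outside `X`, where `restrict` drops its vertices, so the inequality can be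
  -- strict.
  α-restrict : ∀ S → α ((G [ X ]) [ restrict X S ]) ≤ α (G [ S ])
  α-restrict S with I , I⊆ , ind , eq ← α-induced-attained (G [ X ]) (restrict X S) =
    subst (_≤ _) (trans (∣embed∣ X I) eq) (α-induced-≥ G I⊆S ind′)
    where
    I⊆S : embed X I ⊆ S
    I⊆S p with i , i∈I , refl ← ∈-embed⁻ X I p = ∈-restrict⁻ X S (I⊆ i∈I)
    ind′ : IsIndependent G (embed X I)
    ind′ p q with i , i∈I , refl ← ∈-embed⁻ X I p | j , j∈I , refl ← ∈-embed⁻ X I q = ind i∈I j∈I

-- Bounds on tree-α

module _ (G : Graph n) where

  tree-α-attained : Σ (TreeDecomposition G) λ 𝒯 → ∀ t → α (G [ TreeDecomposition.bag 𝒯 t ]) ≤ tree-α G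
  tree-α-attained with 𝒯 , eq ← proj₁ (tree-α-isMinimum G) =
    𝒯 , λ t → ℕₚ.≤-trans (max-upper (λ t → α (G [ TreeDecomposition.bag 𝒯 t ])) t) (ℕₚ.≤-reflexive eq)

  -- Connectivity is asked for as `ConnectedOn`, so that the lemmas on trees apply without
  -- renumbering the nodes.
  tree-α-least : (T : Graph m) → IsTree T → (X : Fin m → Subset n) →
    (∀ v → ∃ λ t → v ∈ X t) →
    (∀ {u v} → Adj G u v → ∃ λ t → u ∈ X t × v ∈ X t) →
    (∀ u → ConnectedOn T (λ t → u ∈ X t)) →
    (∀ t → α (G [ X t ]) ≤ k) → tree-α G ≤ k
  tree-α-least {m = m} T tree X vertices edges conn good =
    ℕₚ.≤-trans (proj₂ (tree-α-isMinimum G) (𝒯 , refl)) (max-least _ good)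
    where
    nodesX : Fin n → Subset m
    nodesX u = tabulate λ t → lookup (X t) u
    𝒯 : TreeDecomposition G
    𝒯 = record
      { T = T ; isTree = tree ; bag = X ; vertices-covered = vertices ; edges-covered = edges
      ; nodes-connected = λ u → connectedOn⇒connected T (nodesX u)
          (connectedOn-resp {T = T}
            (λ p → ∈-tabulate⁺ _ (Vecₚ.[]=⇒lookup p))
            (λ {t} p → Vecₚ.lookup⇒[]= u (X t) (∈-tabulate⁻ _ p)) (conn u))
      }

-- The same tree serves: the nodes whose restricted bag holds `u` are those whose old bag holds
-- `enum S u`, so they stay connected.
tree-α-induced : (G : Graph n) (S : Subset n) → tree-α (G [ S ]) ≤ tree-α G
tree-α-induced G S with 𝒯 , good ← tree-α-attained G =
  tree-α-least (G [ S ]) T isTree (restrict S ∘ bag)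
    (λ v → let t , p = vertices-covered (enum S v) in t , ∈-restrict⁺ S (bag t) p)
    (λ e → let t , p , q = edges-covered e in t , ∈-restrict⁺ S (bag t) p , ∈-restrict⁺ S (bag t) q)
    (λ u → connectedOn-resp {T = T} (∈-restrict⁺ S _) (∈-restrict⁻ S _) (nodes-connectedOn 𝒯 (enum S u)))
    (λ t → ℕₚ.≤-trans (α-restrict G S (bag t)) (good t))
  where open TreeDecomposition 𝒯

-- `helly` applies because adjacent vertices share a bag by `edges-covered`, and a vertex shares one
-- with itself by `vertices-covered`.
clique-in-bag : {G : Graph n} (𝒯 : TreeDecomposition G) {K : Subset n} → IsClique G K →
                ∃ λ t → K ⊆ TreeDecomposition.bag 𝒯 t
clique-in-bag {G = G} 𝒯 {K} clique = helly T isTree bag (nodes-connectedOn 𝒯) K share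
  where
  open TreeDecomposition 𝒯
  share : ∀ {u v} → u ∈ K → v ∈ K → ∃ λ t → u ∈ bag t × v ∈ bag t
  share {u} {v} u∈K v∈K with u Finₚ.≟ v
  ... | yes refl = let t , p = vertices-covered u in t , p , p
  ... | no u≢v   = edges-covered (clique u∈K v∈K u≢v)

-- Bridges

private
  preimages : (f : Fin m → Fin n) → ∀ vs → All (λ v → ∃ λ u → v ≡ f u) vs → ∃ λ us → vs ≡ List.map f us
  preimages f []       []                = [] , refl
  preimages f (_ ∷ vs) ((u , refl) ∷ im) with us , refl ← preimages f vs im = u ∷ us , refl

module _ (J : Graph n) where

  -- This brings a cycle of a joined tree that stays on one side back into that side.
  cycle-comap : (f : Fin m → Fin n) (c : Cycle J) →
                All (λ v → ∃ λ u → v ≡ f u) (Cycle.x c ∷ Cycle.xs c) → Cycle (comap f J)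
  cycle-comap f record { x = _ ; xs = xs ; length≥2 = l ; distinct = d ; closed = L } ((x , refl) ∷ im)
    with ys , refl ← preimages f xs im = record
      { x = x ; xs = ys
      ; length≥2 = subst (2 ≤_) (Listₚ.length-map f ys) l
      ; distinct = Uniqueₚ.map⁻ d
      ; closed = Linkedₚ.map⁻ (subst (Linked _) (cong (f x ∷_) (sym (Listₚ.map-++ f ys (x ∷ [])))) L)
      }

  -- A bridge is given by the vertex set `P` on one side of it: every edge that leaves `P` goes from
  -- `p` to `q`. Edges entering `P` are reversed by `symm`.
  module _ {P : Pred (Fin n) 0ℓ} (P? : Decidable P) {p q : Fin n}
           (bridge : ∀ {u v} → Adj J u v → P u → ¬ P v → u ≡ p × v ≡ q) where

    private
      -- The step that first enters `P` is the bridge taken backwards, from `q` to `p`.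
      return : ∀ y ys {x} → ¬ P y → P x → Linked (Adj J) (y ∷ (ys ∷ʳ x)) → p ∈ₗ ys ∷ʳ x × q ∈ₗ y ∷ ys
      return y [] ¬Py Px (e ∷ [-]) with refl , refl ← bridge (symm J e) Px ¬Py = here refl , here refl
      return y (z ∷ zs) ¬Py Px (e ∷ L) with P? z
      ... | yes Pz with refl , refl ← bridge (symm J e) Pz ¬Py = here refl , here refl
      ... | no ¬Pz = let p∈ , q∈ = return z zs ¬Pz Px L in there p∈ , there q∈

      -- Leaving `P` at `y` makes `y` equal to `p`, and `return` then meets `p` again: either in
      -- `zs`, against distinctness, or as `x`, against `y ≢ x`. At the start of a cycle `y ≢ x`
      -- fails, so `bridge-not-crossed` treats the first edge separately.
      stay : ∀ y ys {x} → P y → P x → y ≢ x → x ∉ₗ ys → Unique (y ∷ ys) →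
             Linked (Adj J) (y ∷ (ys ∷ʳ x)) → All P ys
      stay y []       _  _  _   _  _ _ = []
      stay y (z ∷ zs) Py Px y≢x x∉ ((_ ∷ y∉zs) ∷ u) (e ∷ L) with P? z
      ... | yes Pz = Pz ∷ stay z zs Pz Px (λ { refl → x∉ (here refl) }) (x∉ ∘ there) u L
      ... | no ¬Pz with refl , refl ← bridge e Py ¬Pz
                   with Memₚ.∈-++⁻ zs (proj₁ (return z zs ¬Pz Px L))
      ...   | inj₁ y∈zs        = contradiction refl (All.lookup y∉zs y∈zs)
      ...   | inj₂ (here refl) = contradiction refl y≢x

    bridge-not-crossed : (c : Cycle J) → P (Cycle.x c) → All P (Cycle.x c ∷ Cycle.xs c)
    -- The closed walk `x`, `y`, `x` could use the bridge back and forth; `length≥2` excludes it.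
    bridge-not-crossed record { xs = _ ∷ [] ; length≥2 = s≤s () } _
    bridge-not-crossed record { x = x ; xs = y ∷ z ∷ zs
                              ; distinct = x∉@(x≢y ∷ x≢z ∷ _) ∷ u@(y∉ ∷ _) ; closed = e ∷ L@(d ∷ L′) } Px
      with P? y
    ... | yes Py = Px ∷ Py ∷ stay y (z ∷ zs) Py Px (x≢y ∘ sym) (λ x∈ → All.lookup x∉ (there x∈) refl) u L
    -- The first edge is the bridge, with `x` as `p` and `y` as `q`. Meeting `p` again is no
    -- contradiction, since the cycle closes at `x`. Either `z` is back in `P`, hence equal to `x`,
    -- or the later return passes through `q` a second time.
    ... | no ¬Py with refl , refl ← bridge e Px ¬Py with P? z
    ...   | yes Pz = contradiction (sym (proj₁ (bridge (symm J d) Pz ¬Py))) x≢z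
    ...   | no ¬Pz = contradiction refl (All.lookup y∉ (proj₂ (return z zs ¬Pz Px L′)))

-- The disjoint union of two graphs with an additional edge ab

module _ (T₁ : Graph m) (T₂ : Graph k) (a : Fin m) (b : Fin k) where

  private
    -- On the sum type the kinds of edges are separated by pattern matching; `join` transports the
    -- relation along `splitAt`.
    SumAdj : Fin m ⊎ Fin k → Fin m ⊎ Fin k → Set
    SumAdj (inj₁ s) (inj₁ t) = Adj T₁ s t
    SumAdj (inj₁ s) (inj₂ t) = s ≡ a × t ≡ b
    SumAdj (inj₂ s) (inj₁ t) = s ≡ b × t ≡ a
    SumAdj (inj₂ s) (inj₂ t) = Adj T₂ s t

    sumAdj? : ∀ s t → Dec (SumAdj s t)
    sumAdj? (inj₁ s) (inj₁ t) = adj? T₁ s t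
    sumAdj? (inj₁ s) (inj₂ t) = (s Finₚ.≟ a) ×-dec (t Finₚ.≟ b)
    sumAdj? (inj₂ s) (inj₁ t) = (s Finₚ.≟ b) ×-dec (t Finₚ.≟ a)
    sumAdj? (inj₂ s) (inj₂ t) = adj? T₂ s t

    sumAdj-sym : ∀ s t → SumAdj s t → SumAdj t s
    sumAdj-sym (inj₁ s) (inj₁ t) e       = symm T₁ e
    sumAdj-sym (inj₁ s) (inj₂ t) (p , q) = q , p
    sumAdj-sym (inj₂ s) (inj₁ t) (p , q) = q , p
    sumAdj-sym (inj₂ s) (inj₂ t) e       = symm T₂ e

    sumAdj-irrefl : ∀ s → ¬ SumAdj s s
    sumAdj-irrefl (inj₁ s) = irrefl T₁
    sumAdj-irrefl (inj₂ s) = irrefl T₂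

  join : Graph (m + k)
  join .Adj s t    = SumAdj (splitAt m s) (splitAt m t)
  join .adj? s t   = sumAdj? (splitAt m s) (splitAt m t)
  join .symm {s} {t} = sumAdj-sym (splitAt m s) (splitAt m t)
  join .irrefl {s} = sumAdj-irrefl (splitAt m s)

  private
    -- Phrased as an image, the form in which `cycle-comap` takes its hypothesis.
    Left : Pred (Fin (m + k)) 0ℓ
    Left v = ∃ λ s → v ≡ s ↑ˡ k

    Right : Pred (Fin (m + k)) 0ℓ
    Right v = ∃ λ t → v ≡ m ↑ʳ t

    side : ∀ v → Left v ⊎ Right v
    side v with splitAt m v in eq
    ... | inj₁ s = inj₁ (s , sym (Finₚ.splitAt⁻¹-↑ˡ eq))
    ... | inj₂ t = inj₂ (t , sym (Finₚ.splitAt⁻¹-↑ʳ eq))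

    -- `Fin.join m k` reduces to `_↑ˡ k` on `inj₁` and to `m ↑ʳ_` on `inj₂`, so one lemma serves all
    -- kinds of edges.
    adj⁺ : ∀ x y → SumAdj x y → Adj join (Fin.join m k x) (Fin.join m k y)
    adj⁺ x y = subst₂ SumAdj (sym (Finₚ.splitAt-join m k x)) (sym (Finₚ.splitAt-join m k y))

    adj⁻ : ∀ x y → Adj join (Fin.join m k x) (Fin.join m k y) → SumAdj x y
    adj⁻ x y = subst₂ SumAdj (Finₚ.splitAt-join m k x) (Finₚ.splitAt-join m k y)

    ¬both : ∀ {v} → Left v → ¬ Right v
    ¬both (s , refl) (t , eq)
      with () ← trans (sym (Finₚ.splitAt-↑ˡ m s k)) (trans (cong (splitAt m) eq) (Finₚ.splitAt-↑ʳ m k t))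

    ¬left⇒right : ∀ {v} → ¬ Left v → Right v
    ¬left⇒right {v} ¬l = [ ⊥-elim ∘ ¬l , id ]′ (side v)

    left? : Decidable Left
    left? v = [ yes , (λ r → no λ l → ¬both l r) ]′ (side v)

    right? : Decidable Right
    right? v = [ (λ l → no (¬both l)) , yes ]′ (side v)

    bridgeˡ : ∀ {u v} → Adj join u v → Left u → ¬ Left v → u ≡ a ↑ˡ k × v ≡ m ↑ʳ b
    bridgeˡ e (s , refl) ¬l with t , refl ← ¬left⇒right ¬l
                            with refl , refl ← adj⁻ (inj₁ s) (inj₂ t) e = refl , refl

    bridgeʳ : ∀ {u v} → Adj join u v → Right u → ¬ Right v → u ≡ m ↑ʳ b × v ≡ a ↑ˡ k
    bridgeʳ {v = v} e (s , refl) ¬r with side v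
    ... | inj₂ r = contradiction r ¬r
    ... | inj₁ (t , refl) with refl , refl ← adj⁻ (inj₂ s) (inj₁ t) e = refl , refl

  -- A walk between the two sides is routed through the new edge; `reach` guarantees that `Q` holds
  -- at both of its ends.
  join-connectedOn : ∀ {Q} → ConnectedOn T₁ (λ s → Q (s ↑ˡ k)) → ConnectedOn T₂ (λ t → Q (m ↑ʳ t)) →
    (∀ {s t} → Q (s ↑ˡ k) → Q (m ↑ʳ t) → Q (a ↑ˡ k) × Q (m ↑ʳ b)) → ConnectedOn join Q
  join-connectedOn {Q} conn₁ conn₂ reach {u} {v} qu qv = go (side u) (side v) qu qv
    where
    R = Star (Within join Q)
    in₁ : ∀ {s t} → Q (s ↑ˡ k) → Q (t ↑ˡ k) → R (s ↑ˡ k) (t ↑ˡ k)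
    in₁ q q′ = Star.gmap (_↑ˡ k) (λ (e , r) → adj⁺ (inj₁ _) (inj₁ _) e , r) (conn₁ q q′)
    in₂ : ∀ {s t} → Q (m ↑ʳ s) → Q (m ↑ʳ t) → R (m ↑ʳ s) (m ↑ʳ t)
    in₂ q q′ = Star.gmap (m ↑ʳ_) (λ (e , r) → adj⁺ (inj₂ _) (inj₂ _) e , r) (conn₂ q q′)
    go : ∀ {u v} → Left u ⊎ Right u → Left v ⊎ Right v → Q u → Q v → R u v
    go (inj₁ (s , refl)) (inj₁ (t , refl)) q q′ = in₁ q q′
    go (inj₂ (s , refl)) (inj₂ (t , refl)) q q′ = in₂ q q′
    go (inj₁ (s , refl)) (inj₂ (t , refl)) q q′ = let qa , qb = reach q q′ in
      in₁ q qa ◅◅ (adj⁺ (inj₁ a) (inj₂ b) (refl , refl) , qa , qb) ◅ in₂ qb q′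
    go (inj₂ (s , refl)) (inj₁ (t , refl)) q q′ = let qa , qb = reach q′ q in
      in₂ q qb ◅◅ (adj⁺ (inj₂ b) (inj₁ a) (refl , refl) , qb , qa) ◅ in₁ qa q′

  -- The cycle stays on the side where it starts. Its pullback has the adjacency of `T₁` or `T₂`
  -- only up to computing `splitAt`, which `cycle-map` along `id` corrects.
  join-acyclic : ¬ Cycle T₁ → ¬ Cycle T₂ → ¬ Cycle join
  join-acyclic ac₁ ac₂ c with side (Cycle.x c)
  ... | inj₁ l = ac₁ (cycle-map id id (adj⁻ (inj₁ _) (inj₁ _))
                   (cycle-comap join (_↑ˡ k) c (bridge-not-crossed join left? bridgeˡ c l)))
  ... | inj₂ r = ac₂ (cycle-map id id (adj⁻ (inj₂ _) (inj₂ _))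
                   (cycle-comap join (m ↑ʳ_) c (bridge-not-crossed join right? bridgeʳ c r)))

  join-isTree : IsTree T₁ → IsTree T₂ → IsTree join
  join-isTree tree₁ tree₂ = record
    { nonempty  = a ↑ˡ k
    ; connected = λ s t → Star.map proj₁ (join-connectedOn {Q = λ _ → ⊤₀}
        (connected⇒connectedOn-⊤ T₁ (IsTree.connected tree₁))
        (connected⇒connectedOn-⊤ T₂ (IsTree.connected tree₂)) _ {s} {t} _ _)
    ; acyclic   = join-acyclic (IsTree.acyclic tree₁) (IsTree.acyclic tree₂)
    }

-- Clique sums

module _ (G : Graph n) (S : Subset n) (𝒯 : TreeDecomposition (G [ S ])) where
  open TreeDecomposition 𝒯

  embed-connectedOn : ∀ u → ConnectedOn T (λ t → u ∈ embed S (bag t))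
  -- The membership `p` supplies the preimage `i` of `u`; for `u` outside `S` there are no nodes to
  -- connect.
  embed-connectedOn u {s} p q with i , _ , refl ← ∈-embed⁻ S (bag s) p =
    connectedOn-resp {T = T} (∈-embed⁺ S _) (enum-∈-embed⁻ S _) (nodes-connectedOn 𝒯 i) p q

  embed-vertices-covered : ∀ {v} → v ∈ S → ∃ λ t → v ∈ embed S (bag t)
  embed-vertices-covered v∈S = let t , p = vertices-covered (index S v∈S) in
    t , subst (_∈ embed S (bag t)) (enum-index S v∈S) (∈-embed⁺ S (bag t) p)

  embed-edges-covered : ∀ {u v} → u ∈ S → v ∈ S → Adj G u v →
                        ∃ λ t → u ∈ embed S (bag t) × v ∈ embed S (bag t)
  embed-edges-covered u∈S v∈S e =
    let t , p , q = edges-covered (subst₂ (Adj G) (sym (enum-index S u∈S)) (sym (enum-index S v∈S)) e) in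
    t , subst (_∈ embed S (bag t)) (enum-index S u∈S) (∈-embed⁺ S (bag t) p)
      , subst (_∈ embed S (bag t)) (enum-index S v∈S) (∈-embed⁺ S (bag t) q)

  -- `restrict S K` is a clique of `G [ S ]` because `enum S` is injective, and by `K ⊆ S` every
  -- vertex of `K` has an index in it.
  clique-in-embed : ∀ {K} → K ⊆ S → IsClique G K → ∃ λ t → K ⊆ embed S (bag t)
  clique-in-embed {K} K⊆S clique =
    let t , sub = clique-in-bag 𝒯 {restrict S K} λ p q u≢v →
          clique (∈-restrict⁻ S K p) (∈-restrict⁻ S K q) (u≢v ∘ enum-injective S)
    in t , λ v∈K → let eq = enum-index S (K⊆S v∈K) in
      subst (_∈ embed S (bag t)) eq (∈-embed⁺ S (bag t) (sub (∈-restrict⁺ S K (subst (_∈ K) (sym eq) v∈K))))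

-- The upper bound in a form symmetric in the two sides, to be used with `A ∪ C` and `B ∪ C`.
tree-α-cliqueSum : (G : Graph n) (S₁ S₂ : Subset n) → (∀ v → v ∈ S₁ ⊎ v ∈ S₂) →
  (∀ {u v} → Adj G u v → (u ∈ S₁ × v ∈ S₁) ⊎ (u ∈ S₂ × v ∈ S₂)) →
  IsClique G (S₁ ∩ S₂) → tree-α G ≤ tree-α (G [ S₁ ]) ⊔ tree-α (G [ S₂ ])
tree-α-cliqueSum {n = n} G S₁ S₂ vertices edges clique
  with 𝒯₁ , good₁ ← tree-α-attained (G [ S₁ ]) | 𝒯₂ , good₂ ← tree-α-attained (G [ S₂ ])
  with a , sub₁ ← clique-in-embed G S₁ 𝒯₁ (Subₚ.p∩q⊆p S₁ S₂) clique
     | b , sub₂ ← clique-in-embed G S₂ 𝒯₂ (Subₚ.p∩q⊆q S₁ S₂) clique =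
  tree-α-least G J (join-isTree T₁.T T₂.T a b T₁.isTree T₂.isTree) X
    (λ v → [ (λ p → let t , q = embed-vertices-covered G S₁ 𝒯₁ p in t ↑ˡ k₂ , X₁⁺ t q)
           , (λ p → let t , q = embed-vertices-covered G S₂ 𝒯₂ p in k₁ ↑ʳ t , X₂⁺ t q) ]′ (vertices v))
    (λ e → [ (λ (p , q) → let t , p′ , q′ = embed-edges-covered G S₁ 𝒯₁ p q e in
                          t ↑ˡ k₂ , X₁⁺ t p′ , X₁⁺ t q′)
           , (λ (p , q) → let t , p′ , q′ = embed-edges-covered G S₂ 𝒯₂ p q e in
                          k₁ ↑ʳ t , X₂⁺ t p′ , X₂⁺ t q′) ]′ (edges e))
    (λ u → join-connectedOn T₁.T T₂.T a b
      (connectedOn-resp {T = T₁.T} (X₁⁺ _) (X₁⁻ _) (embed-connectedOn G S₁ 𝒯₁ u))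
      (connectedOn-resp {T = T₂.T} (X₂⁺ _) (X₂⁻ _) (embed-connectedOn G S₂ 𝒯₂ u))
      -- A vertex with bags on both sides lies in `S₁ ∩ S₂`, hence in the bags at `a` and `b`, which
      -- were chosen to contain this clique.
      λ {s} {t} p q →
        let u∈ = Subₚ.x∈p∩q⁺ (embed-⊆ S₁ (T₁.bag s) (X₁⁻ s p) , embed-⊆ S₂ (T₂.bag t) (X₂⁻ t q))
        in X₁⁺ a (sub₁ u∈) , X₂⁺ b (sub₂ u∈))
    (λ t → good (splitAt k₁ t))
  where
  module T₁ = TreeDecomposition 𝒯₁
  module T₂ = TreeDecomposition 𝒯₂
  k₁ = T₁.size
  k₂ = T₂.size
  J = join T₁.T T₂.T a b
  Y : Fin k₁ ⊎ Fin k₂ → Subset n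
  Y = [ (λ s → embed S₁ (T₁.bag s)) , (λ t → embed S₂ (T₂.bag t)) ]′
  X : Fin (k₁ + k₂) → Subset n
  X = Y ∘ splitAt k₁
  X₁⁺ : ∀ s {u} → u ∈ embed S₁ (T₁.bag s) → u ∈ X (s ↑ˡ k₂)
  X₁⁺ s = subst (λ z → _ ∈ Y z) (sym (Finₚ.splitAt-↑ˡ k₁ s k₂))
  X₁⁻ : ∀ s {u} → u ∈ X (s ↑ˡ k₂) → u ∈ embed S₁ (T₁.bag s)
  X₁⁻ s = subst (λ z → _ ∈ Y z) (Finₚ.splitAt-↑ˡ k₁ s k₂)
  X₂⁺ : ∀ t {u} → u ∈ embed S₂ (T₂.bag t) → u ∈ X (k₁ ↑ʳ t)
  X₂⁺ t = subst (λ z → _ ∈ Y z) (sym (Finₚ.splitAt-↑ʳ k₁ k₂ t))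
  X₂⁻ : ∀ t {u} → u ∈ X (k₁ ↑ʳ t) → u ∈ embed S₂ (T₂.bag t)
  X₂⁻ t = subst (λ z → _ ∈ Y z) (Finₚ.splitAt-↑ʳ k₁ k₂ t)
  good : ∀ z → α (G [ Y z ]) ≤ tree-α (G [ S₁ ]) ⊔ tree-α (G [ S₂ ])
  good (inj₁ s) = ℕₚ.≤-trans (α-embed G S₁ (T₁.bag s)) (ℕₚ.≤-trans (good₁ s) (ℕₚ.m≤m⊔n _ _))
  good (inj₂ t) = ℕₚ.≤-trans (α-embed G S₂ (T₂.bag t)) (ℕₚ.≤-trans (good₂ t) (ℕₚ.m≤n⊔m _ _))

-- Clique cutsets

corollary3p11 : ∀ {n : ℕ} (G : Graph n) (A B C : Subset n) → IsCliqueCutset G C → IsCutPartition G A B C → tree-α G ≡ tree-α (G [ A ∪ C ]) ⊔ tree-α (G [ B ∪ C ])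
corollary3p11 G A B C (clique , _) part = ℕₚ.≤-antisym
  (tree-α-cliqueSum G (A ∪ C) (B ∪ C) vertices edges
    -- A subset of a clique is a clique, so one inclusion between the intersection and `C` suffices.
    λ p q → clique (A∪C∩B∪C⊆C p) (A∪C∩B∪C⊆C q))
  (ℕₚ.⊔-lub (tree-α-induced G (A ∪ C)) (tree-α-induced G (B ∪ C)))
  where
  open IsCutPartition part

  A⊆A∪C : A ⊆ A ∪ C
  A⊆A∪C = Subₚ.p⊆p∪q C
  B⊆B∪C : B ⊆ B ∪ C
  B⊆B∪C = Subₚ.p⊆p∪q C
  C⊆A∪C : C ⊆ A ∪ C
  C⊆A∪C = Subₚ.q⊆p∪q A C
  C⊆B∪C : C ⊆ B ∪ C
  C⊆B∪C = Subₚ.q⊆p∪q B C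

  cases : ∀ v → v ∈ A ⊎ v ∈ B ⊎ v ∈ C
  cases v = Sum.map₂ (Subₚ.x∈p∪q⁻ B C)
    (Subₚ.x∈p∪q⁻ A (B ∪ C) (subst (v ∈_) (sym cover) Subₚ.∈⊤))

  vertices : ∀ v → v ∈ A ∪ C ⊎ v ∈ B ∪ C
  vertices v = Sum.map A⊆A∪C [ B⊆B∪C , C⊆B∪C ]′ (cases v)

  -- Only an edge between `A` and `B` would fit neither side. An edge inside `C` fits both and is
  -- assigned to the second by choice.
  edges : ∀ {u v} → Adj G u v → (u ∈ A ∪ C × v ∈ A ∪ C) ⊎ (u ∈ B ∪ C × v ∈ B ∪ C)
  edges {u} {v} e with cases u | cases v
  ... | inj₁ p        | inj₁ q        = inj₁ (A⊆A∪C p , A⊆A∪C q)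
  ... | inj₁ p        | inj₂ (inj₁ q) = contradiction e (no-edges p q)
  ... | inj₁ p        | inj₂ (inj₂ q) = inj₁ (A⊆A∪C p , C⊆A∪C q)
  ... | inj₂ (inj₁ p) | inj₁ q        = contradiction (symm G e) (no-edges q p)
  ... | inj₂ (inj₁ p) | inj₂ (inj₁ q) = inj₂ (B⊆B∪C p , B⊆B∪C q)
  ... | inj₂ (inj₁ p) | inj₂ (inj₂ q) = inj₂ (B⊆B∪C p , C⊆B∪C q)
  ... | inj₂ (inj₂ p) | inj₁ q        = inj₁ (C⊆A∪C p , A⊆A∪C q)
  ... | inj₂ (inj₂ p) | inj₂ (inj₁ q) = inj₂ (C⊆B∪C p , B⊆B∪C q)
  ... | inj₂ (inj₂ p) | inj₂ (inj₂ q) = inj₂ (C⊆B∪C p , C⊆B∪C q)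

  A∪C∩B∪C⊆C : (A ∪ C) ∩ (B ∪ C) ⊆ C
  A∪C∩B∪C⊆C p with p₁ , p₂ ← Subₚ.x∈p∩q⁻ (A ∪ C) (B ∪ C) p
    with Subₚ.x∈p∪q⁻ A C p₁ | Subₚ.x∈p∪q⁻ B C p₂
  ... | inj₂ v∈C | _        = v∈C
  ... | _        | inj₂ v∈C = v∈C
  ... | inj₁ v∈A | inj₁ v∈B = contradiction (_ , Subₚ.x∈p∩q⁺ (v∈A , v∈B)) A∩B-empty
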